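{- Let $\mathbf{k}$ be a commutative ring, $E_\bullet$ a standard quotient flag over $\mathbf{k}$, and $k\ge1$. If the diagram $D$ is $k$-full, then the natural surjection $\mathsf{R}_{k+1}E_\bullet^D\to\mathsf{R}_kE_\bullet^D$ is an isomorphism.
   Context: Diagrams. A diagram is a finite tuple $D=[a^{(1)},\dots,a^{(m)}]$ of finite subsets of $\mathbb{Z}_{>0}$ (its columns). $D$ is $k$-full if for every column $a^{(j)}$, $k\in a^{(j)}$ implies $k+1\in a^{(j)}$. Standard flag. Let $n$ be large enough that $n\geq k$ and all boxes of $D$ are in rows $1,\dots,n$ (all $a^{(j)}\subseteq\{1,\dots,n\}$). $E$ is a free $\mathbf{k}$-module with basis $z_1,\dots,z_n$ and $E_i=E/\langle z_{i+1},\dots,z_n\rangle$ for $0\le i\le n$, so $E_\bullet$: $E=E_n\to\cdots\to E_1\to E_0=0$. Flagged Schur modules. Let $F_\bullet=(F_n\to\cdots\to F_1)$ be any flag of quotients of $E$. Put $TE^D=\bigwedge^{r_1}E\otimes\cdots\otimes\bigwedge^{r_m}E$ with $r_j=|a^{(j)}|$; it has basis $z_\tau=\bigotimes_j z_{b^{(j)}_1}\wedge\cdots\wedge z_{b^{(j)}_{r_j}}$, where $\tau=(b^{(1)},\dots,b^{(m)})$, $b^{(j)}=\{b^{(j)}_1<\dots<b^{(j)}_{r_j}\}\subseteq\{1,\dots,n\}$. The $D$-exchange relations are the elements of the kernel of $TE^D\to\mathbf{k}[z_{pq}]_{1\le p,q\le n}$, $z_\tau\mapsto\prod_j\Delta_{a^{(j)},b^{(j)}}$,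 where $\Delta_{a,b}$ is the minor of the generic matrix $(z_{pq})$ on rows $a$ and columns $b$. For $a=\{a_1<\dots<a_r\}$, let $F_\bullet^a$ be the quotient of $\bigwedge^rE$ by the sum over $0\le i<r$ of the images of $\bigwedge^iE\otimes\bigwedge^{r-i}\ker(E\to F_{a_{i+1}})$; put $TF_\bullet^D=\bigotimes_jF_\bullet^{a^{(j)}}$. The flagged Schur module $F_\bullet^D$ is the quotient of $TF_\bullet^D$ by the image of the $D$-exchange relations. It is functorial in $F_\bullet$. Bergeron–Sottile operators on flags: $\mathsf{R}_kE_\bullet$ is the flag with $(\mathsf{R}_kE_\bullet)_i=E_i$ for $i<k$ and $(\mathsf{R}_kE_\bullet)_i=E_{i-1}$ for $i\ge k$. The notation $\mathsf{R}_kE_\bullet^D$ means $(\mathsf{R}_kE_\bullet)^D$. The surjection of flags $\mathsf{R}_{k+1}E_\bullet\to\mathsf{R}_kE_\bullet$ (the projection $E_k\to E_{k-1}$ in position $k$, identity elsewhere) induces the surjection in the statement. -}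

module Defs where

open import Level using (Level; _⊔_) renaming (suc to lsuc)
open import Algebra.Bundles using (CommutativeRing; RawRing; AbelianGroup)
open import Algebra.Module.Bundles using (Module)
open import Algebra.Module.Morphism.Structures using (IsModuleHomomorphism; IsModuleIsomorphism)
open import Algebra.Module.Structures using (IsModule)
open import Algebra.Module.Structures.Biased using (IsModuleFromLeft)
import Algebra.Definitions.RawMonoid as RawMonoidDefs
import Algebra.Definitions.RawSemiring as RawSemiringDefs
import Algebra.Properties.AbelianGroup as AbelianGroupProperties
import Algebra.Properties.CommutativeSemigroup as CommutativeSemigroupProperties
open import Data.Bool.Base using (if_then_else_; _∧_)
open import Data.Empty using (⊥-elim)
open import Data.Fin.Base as Fin using (Fin; toℕ; fromℕ<; punchIn)
open import Data.Fin.Properties as Fin using ()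
open import Data.List.Base as List using (List; []; _∷_; _++_)
open import Data.Nat.Base as ℕ using (ℕ; zero; suc; pred; _≤_; _<_)
import Data.Nat.Properties as ℕ
open import Data.Product.Base using (∃; ∃-syntax; Σ-syntax; _×_; _,_; proj₁; proj₂)
open import Data.Vec.Base as Vec using (Vec)
import Data.Vec.Properties as Vec
open import Data.Vec.Functional using (Vector)
open import Function.Base using (id; flip; _∘_)
open import Function.Definitions using (Surjective)
open import Relation.Binary.Core using (Rel)
open import Relation.Binary.Structures using (IsEquivalence)
open import Relation.Binary.Definitions using (DecidableEquality)
open import Relation.Binary.PropositionalEquality.Core using (_≡_; _≢_)
open import Relation.Nullary.Decidable.Core using (does; yes; no)
open import Relation.Unary using (Pred)

private
  variable
    c ℓ m m′ m″ ℓm ℓm′ ℓm″ x ℓx p q e ℓe o o′ ℓo ℓo′ : Level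

-- A finite subset of ℤ_{>0}, as the increasing enumeration of its elements.
record Column : Set where
  field
    size       : ℕ
    box        : Vector ℕ size
    positive   : ∀ s → 0 < box s
    increasing : ∀ {s t} → s Fin.< t → box s < box t

open Column public

infix 4 _∈_

_∈_ : ℕ → Column → Set
i ∈ a = ∃[ s ] box a s ≡ i

Diagram : ℕ → Set
Diagram d = Vector Column d

Full : ℕ → ∀ {d} → Diagram d → Set
Full k D = ∀ j → k ∈ D j → suc k ∈ D j

InRows : ℕ → ∀ {d} → Diagram d → Set
InRows n D = ∀ j s → box (D j) s ≤ n

-- Rows 1,…,n are indexed by Fin n.
row : ∀ {n} → Fin n → ℕ
row i = suc (toℕ i)

boxRow : ∀ {n} (a : Column) → (∀ s → box a s ≤ n) → Vector (Fin n) (size a)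
boxRow a a≤n s = fromℕ< (pred< (box a s) (positive a s) (a≤n s))
  where
  pred< : ∀ {n} b → 0 < b → b ≤ n → pred b < n
  pred< (suc b) _ b<n = b<n

module _ {c ℓ} {R : CommutativeRing c ℓ} where

  open CommutativeRing R using (Carrier; _≈_; 0#; 1#; ring) renaming (_+_ to _+ᴿ_; _*_ to _*ᴿ_)

  record Hom (M : Module R m ℓm) (N : Module R m′ ℓm′)
             : Set (c ⊔ m ⊔ ℓm ⊔ m′ ⊔ ℓm′) where
    private
      module M = Module M
      module N = Module N
    field
      ⟦_⟧ : M.Carrierᴹ → N.Carrierᴹ
      isHom : IsModuleHomomorphism M.rawModule N.rawModule ⟦_⟧

    open IsModuleHomomorphism isHom public
      using (⟦⟧-cong; +ᴹ-homo; 0ᴹ-homo; -ᴹ-homo; *ₗ-homo; *ᵣ-homo)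

  open Hom public using (⟦_⟧)

  -- The law-proofs of modules and linear maps are opaque to keep conversion checking cheap;
  -- carriers, equalities and operations unfold.
  opaque
    isModuleHomomorphism :
      (M : Module R m ℓm) (N : Module R m′ ℓm′) →
      (f : Module.Carrierᴹ M → Module.Carrierᴹ N) →
      (∀ {u v} → Module._≈ᴹ_ M u v → Module._≈ᴹ_ N (f u) (f v)) →
      (∀ u v → Module._≈ᴹ_ N (f (Module._+ᴹ_ M u v)) (Module._+ᴹ_ N (f u) (f v))) →
      (∀ r u → Module._≈ᴹ_ N (f (Module._*ₗ_ M r u)) (Module._*ₗ_ N r (f u))) →
      IsModuleHomomorphism (Module.rawModule M) (Module.rawModule N) f
    isModuleHomomorphism M N f f-cong f-+ f-* = record
      { isBimoduleHomomorphism = record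
        { +ᴹ-isGroupHomomorphism = record
          { isMonoidHomomorphism = record
            { isMagmaHomomorphism = record
              { isRelHomomorphism = record { cong = f-cong }
              ; homo = f-+
              }
            ; ε-homo = f-0
            }
          ; ⁻¹-homo = f-neg
          }
        ; *ₗ-homo = f-*
        ; *ᵣ-homo = λ r u →
            N.≈ᴹ-trans (f-cong (M.≈ᴹ-sym (M.*ₗ-*ᵣ-coincident r u)))
              (N.≈ᴹ-trans (f-* r u) (N.*ₗ-*ᵣ-coincident r (f u)))
        }
      }
      where
      module M = Module M
      module N = Module N
      f-0 : f M.0ᴹ N.≈ᴹ N.0ᴹ
      f-0 = N.≈ᴹ-trans (f-cong (M.≈ᴹ-sym (M.*ₗ-zeroˡ M.0ᴹ)))
              (N.≈ᴹ-trans (f-* 0# M.0ᴹ) (N.*ₗ-zeroˡ (f M.0ᴹ)))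
      f-neg : ∀ u → f (M.-ᴹ u) N.≈ᴹ N.-ᴹ f u
      f-neg u = AbelianGroupProperties.inverseˡ-unique N.+ᴹ-abelianGroup (f (M.-ᴹ u)) (f u)
        (N.≈ᴹ-trans (N.≈ᴹ-sym (f-+ (M.-ᴹ u) u))
          (N.≈ᴹ-trans (f-cong (M.-ᴹ‿inverseˡ u)) f-0))

  mkHom : (M : Module R m ℓm) (N : Module R m′ ℓm′) →
          (f : Module.Carrierᴹ M → Module.Carrierᴹ N) →
          (∀ {u v} → Module._≈ᴹ_ M u v → Module._≈ᴹ_ N (f u) (f v)) →
          (∀ u v → Module._≈ᴹ_ N (f (Module._+ᴹ_ M u v)) (Module._+ᴹ_ N (f u) (f v))) →
          (∀ r u → Module._≈ᴹ_ N (f (Module._*ₗ_ M r u)) (Module._*ₗ_ N r (f u))) →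
          Hom M N
  mkHom M N f f-cong f-+ f-* = record
    { ⟦_⟧ = f
    ; isHom = isModuleHomomorphism M N f f-cong f-+ f-*
    }

  IsIso : {M : Module R m ℓm} {N : Module R m′ ℓm′} → Hom M N → Set _
  IsIso {M = M} {N = N} f =
    IsModuleIsomorphism (Module.rawModule M) (Module.rawModule N) ⟦ f ⟧

  Ker : {M : Module R m ℓm} {N : Module R m′ ℓm′} → Hom M N → Pred (Module.Carrierᴹ M) ℓm′
  Ker {N = N} f v = Module._≈ᴹ_ N (⟦ f ⟧ v) (Module.0ᴹ N)

  mkIsModule : (M : Set m) (_≈ᴹ_ : Rel M ℓm) (_+ᴹ_ : M → M → M) (_*ₗ_ : Carrier → M → M)
               (0ᴹ : M) (-ᴹ_ : M → M) →
               IsEquivalence _≈ᴹ_ →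
               (∀ {u u′ v v′} → u ≈ᴹ u′ → v ≈ᴹ v′ → (u +ᴹ v) ≈ᴹ (u′ +ᴹ v′)) →
               (∀ {r r′ u u′} → r ≈ r′ → u ≈ᴹ u′ → (r *ₗ u) ≈ᴹ (r′ *ₗ u′)) →
               (∀ {u u′} → u ≈ᴹ u′ → (-ᴹ u) ≈ᴹ (-ᴹ u′)) →
               (∀ u v w → ((u +ᴹ v) +ᴹ w) ≈ᴹ (u +ᴹ (v +ᴹ w))) →
               (∀ u v → (u +ᴹ v) ≈ᴹ (v +ᴹ u)) →
               (∀ u → (0ᴹ +ᴹ u) ≈ᴹ u) →
               (∀ u → ((-ᴹ u) +ᴹ u) ≈ᴹ 0ᴹ) →
               (∀ r u v → (r *ₗ (u +ᴹ v)) ≈ᴹ ((r *ₗ u) +ᴹ (r *ₗ v))) →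
               (∀ r s u → ((r +ᴿ s) *ₗ u) ≈ᴹ ((r *ₗ u) +ᴹ (s *ₗ u))) →
               (∀ r s u → ((r *ᴿ s) *ₗ u) ≈ᴹ (r *ₗ (s *ₗ u))) →
               (∀ u → (1# *ₗ u) ≈ᴹ u) →
               (∀ u → (0# *ₗ u) ≈ᴹ 0ᴹ) →
               (∀ r → (r *ₗ 0ᴹ) ≈ᴹ 0ᴹ) →
               IsModule R _≈ᴹ_ _+ᴹ_ 0ᴹ -ᴹ_ _*ₗ_ (flip _*ₗ_)
  mkIsModule M _≈ᴹ_ _+ᴹ_ _*ₗ_ 0ᴹ -ᴹ_ isEq +-cong *-cong neg-cong
             assoc comm idˡ invˡ distribˡ distribʳ *-assoc *-id zeroˡ zeroʳ =
    IsModuleFromLeft.isModule record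
      { isLeftModule = record
        { isLeftSemimodule = record
          { +ᴹ-isCommutativeMonoid = record
            { isMonoid = record
              { isSemigroup = record
                { isMagma = record { isEquivalence = isEq ; ∙-cong = +-cong }
                ; assoc = assoc
                }
              ; identity = idˡ , λ u → Eq.trans (comm u 0ᴹ) (idˡ u)
              }
            ; comm = comm
            }
          ; isPreleftSemimodule = record
            { *ₗ-cong = *-cong
            ; *ₗ-zeroˡ = zeroˡ
            ; *ₗ-distribʳ = λ u r s → distribʳ r s u
            ; *ₗ-identityˡ = *-id
            ; *ₗ-assoc = *-assoc
            ; *ₗ-zeroʳ = zeroʳ
            ; *ₗ-distribˡ = distribˡ
            }
          }
        ; -ᴹ‿cong = neg-cong
        ; -ᴹ‿inverse = invˡ , λ u → Eq.trans (comm u (-ᴹ u)) (invˡ u)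
        }
      }
    where
    module Eq = IsEquivalence isEq

  data Span (M : Module R m ℓm) (P : Pred (Module.Carrierᴹ M) p)
            : Pred (Module.Carrierᴹ M) (c ⊔ m ⊔ ℓm ⊔ p) where
    incl : ∀ {u} → P u → Span M P u
    zero : Span M P (Module.0ᴹ M)
    add  : ∀ {u v} → Span M P u → Span M P v → Span M P (Module._+ᴹ_ M u v)
    neg  : ∀ {u} → Span M P u → Span M P (Module.-ᴹ_ M u)
    mul  : ∀ r {u} → Span M P u → Span M P (Module._*ₗ_ M r u)
    resp : ∀ {u v} → Module._≈ᴹ_ M u v → Span M P u → Span M P v

  Modulo : (M : Module R m ℓm) → Pred (Module.Carrierᴹ M) p → Rel (Module.Carrierᴹ M) _
  Modulo M P u v = Span M P (u +ᴹ -ᴹ v)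
    where open Module M

  opaque
    /-isModule : (M : Module R m ℓm) (P : Pred (Module.Carrierᴹ M) p) → let open Module M in
                 IsModule R (Modulo M P) _+ᴹ_ 0ᴹ -ᴹ_ _*ₗ_ (flip _*ₗ_)
    /-isModule M P =
      mkIsModule Carrierᴹ (Modulo M P) _+ᴹ_ _*ₗ_ 0ᴹ -ᴹ_
        record
          { refl = λ {u} → resp (≈ᴹ-sym (-ᴹ‿inverseʳ u)) zero
          ; sym = λ {u} {v} h → resp (neg-sub u v) (neg h)
          ; trans = λ {u} {v} {w} h h′ → resp (sub-trans u v w) (add h h′)
          }
        (λ {u} {u′} {v} {v′} h h′ → resp (add-sub u u′ v v′) (add h h′))
        (λ {r} {r′} {u} {u′} r≈r′ h → resp (mul-sub r≈r′ u u′) (mul r h))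
        (λ {u} {u′} h → resp (≈ᴹ-sym (⁻¹-∙-comm u (-ᴹ u′))) (neg h))
        (λ u v w → of≈ (+ᴹ-assoc u v w))
        (λ u v → of≈ (+ᴹ-comm u v))
        (λ u → of≈ (+ᴹ-identityˡ u))
        (λ u → of≈ (-ᴹ‿inverseˡ u))
        (λ r u v → of≈ (*ₗ-distribˡ r u v))
        (λ r s u → of≈ (*ₗ-distribʳ u r s))
        (λ r s u → of≈ (*ₗ-assoc r s u))
        (λ u → of≈ (*ₗ-identityˡ u))
        (λ u → of≈ (*ₗ-zeroˡ u))
        (λ r → of≈ (*ₗ-zeroʳ r))
      where
      open Module M
      open AbelianGroupProperties +ᴹ-abelianGroup
        using (⁻¹-∙-comm; ⁻¹-involutive; inverseˡ-unique)
      open CommutativeSemigroupProperties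
        (AbelianGroup.commutativeSemigroup +ᴹ-abelianGroup) using (interchange)

      of≈ : ∀ {u v} → u ≈ᴹ v → Modulo M P u v
      of≈ {u} {v} u≈v =
        resp (≈ᴹ-trans (≈ᴹ-sym (-ᴹ‿inverseʳ v)) (+ᴹ-congʳ (≈ᴹ-sym u≈v))) zero

      neg-sub : ∀ u v → -ᴹ (u +ᴹ -ᴹ v) ≈ᴹ v +ᴹ -ᴹ u
      neg-sub u v = ≈ᴹ-trans (≈ᴹ-sym (⁻¹-∙-comm u (-ᴹ v)))
        (≈ᴹ-trans (+ᴹ-congˡ (⁻¹-involutive v)) (+ᴹ-comm (-ᴹ u) v))

      sub-trans : ∀ u v w → (u +ᴹ -ᴹ v) +ᴹ (v +ᴹ -ᴹ w) ≈ᴹ u +ᴹ -ᴹ w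
      sub-trans u v w = ≈ᴹ-trans (+ᴹ-assoc u (-ᴹ v) (v +ᴹ -ᴹ w))
        (+ᴹ-congˡ (≈ᴹ-trans (≈ᴹ-sym (+ᴹ-assoc (-ᴹ v) v (-ᴹ w)))
          (≈ᴹ-trans (+ᴹ-congʳ (-ᴹ‿inverseˡ v)) (+ᴹ-identityˡ (-ᴹ w)))))

      add-sub : ∀ u u′ v v′ →
                (u +ᴹ -ᴹ u′) +ᴹ (v +ᴹ -ᴹ v′) ≈ᴹ (u +ᴹ v) +ᴹ -ᴹ (u′ +ᴹ v′)
      add-sub u u′ v v′ = ≈ᴹ-trans (interchange u (-ᴹ u′) v (-ᴹ v′)) (+ᴹ-congˡ (⁻¹-∙-comm u′ v′))

      mul-neg : ∀ r u → r *ₗ (-ᴹ u) ≈ᴹ -ᴹ (r *ₗ u)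
      mul-neg r u = inverseˡ-unique (r *ₗ (-ᴹ u)) (r *ₗ u)
        (≈ᴹ-trans (≈ᴹ-sym (*ₗ-distribˡ r (-ᴹ u) u))
          (≈ᴹ-trans (*ₗ-congˡ (-ᴹ‿inverseˡ u)) (*ₗ-zeroʳ r)))

      mul-sub : ∀ {r r′} → r ≈ r′ → ∀ u u′ → r *ₗ (u +ᴹ -ᴹ u′) ≈ᴹ (r *ₗ u) +ᴹ -ᴹ (r′ *ₗ u′)
      mul-sub {r} r≈r′ u u′ = ≈ᴹ-trans (*ₗ-distribˡ r u (-ᴹ u′))
        (+ᴹ-congˡ (≈ᴹ-trans (mul-neg r u′) (-ᴹ‿cong (*ₗ-congʳ r≈r′))))

  infixl 7 _/_

  -- The quotient by the submodule generated by P, on the carrier of M.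
  _/_ : (M : Module R m ℓm) → Pred (Module.Carrierᴹ M) p → Module R m (c ⊔ m ⊔ ℓm ⊔ p)
  M / P = record
    { Carrierᴹ = Carrierᴹ ; _≈ᴹ_ = Modulo M P ; _+ᴹ_ = _+ᴹ_
    ; _*ₗ_ = _*ₗ_ ; _*ᵣ_ = flip _*ₗ_ ; 0ᴹ = 0ᴹ ; -ᴹ_ = -ᴹ_
    ; isModule = /-isModule M P
    }
    where open Module M

  /-incl : (M : Module R m ℓm) (P : Pred (Module.Carrierᴹ M) p) →
           ∀ {u} → Span M P u → Module._≈ᴹ_ (M / P) u (Module.0ᴹ M)
  /-incl M P {u} h = resp (≈ᴹ-sym (≈ᴹ-trans (+ᴹ-congˡ ε⁻¹≈ε) (+ᴹ-identityʳ u))) h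
    where
    open Module M
    open AbelianGroupProperties +ᴹ-abelianGroup using (ε⁻¹≈ε)

  /-cong : (M : Module R m ℓm) (P : Pred (Module.Carrierᴹ M) p) →
           ∀ {u v} → Module._≈ᴹ_ M u v → Module._≈ᴹ_ (M / P) u v
  /-cong M P {u} {v} u≈v =
    resp (≈ᴹ-trans (≈ᴹ-sym (-ᴹ‿inverseʳ v)) (+ᴹ-congʳ (≈ᴹ-sym u≈v))) zero
    where open Module M

  /-lift : {M : Module R m ℓm} {N : Module R m′ ℓm′} {P : Pred (Module.Carrierᴹ M) p}
           (f : Hom M N) → (∀ {u} → P u → Ker f u) → Hom (M / P) N
  /-lift {M = M} {N = N} {P = P} f P⇒Ker =
    mkHom (M / P) N ⟦ f ⟧ cong (Hom.+ᴹ-homo f) (Hom.*ₗ-homo f)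
    where
    module M = Module M
    open Module N
    open AbelianGroupProperties +ᴹ-abelianGroup using (ε⁻¹≈ε; x∙y⁻¹≈ε⇒x≈y)

    kills : ∀ {u} → Span M P u → Ker f u
    kills (incl h)    = P⇒Ker h
    kills zero        = Hom.0ᴹ-homo f
    kills (add h h′)  = ≈ᴹ-trans (Hom.+ᴹ-homo f _ _)
                          (≈ᴹ-trans (+ᴹ-cong (kills h) (kills h′)) (+ᴹ-identityˡ 0ᴹ))
    kills (neg h)     = ≈ᴹ-trans (Hom.-ᴹ-homo f _) (≈ᴹ-trans (-ᴹ‿cong (kills h)) ε⁻¹≈ε)
    kills (mul r h)   = ≈ᴹ-trans (Hom.*ₗ-homo f r _)
                          (≈ᴹ-trans (*ₗ-congˡ (kills h)) (*ₗ-zeroʳ r))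
    kills (resp eq h) = ≈ᴹ-trans (Hom.⟦⟧-cong f (M.≈ᴹ-sym eq)) (kills h)

    cong : ∀ {u v} → Span M P (u M.+ᴹ M.-ᴹ v) → ⟦ f ⟧ u ≈ᴹ ⟦ f ⟧ v
    cong {u} {v} h = x∙y⁻¹≈ε⇒x≈y (⟦ f ⟧ u) (⟦ f ⟧ v)
      (≈ᴹ-trans (+ᴹ-congˡ (≈ᴹ-sym (Hom.-ᴹ-homo f v)))
        (≈ᴹ-trans (≈ᴹ-sym (Hom.+ᴹ-homo f u (M.-ᴹ v))) (kills h)))

  /-proj : (M : Module R m ℓm) (P : Pred (Module.Carrierᴹ M) p) → Hom M (M / P)
  /-proj M P = mkHom M (M / P) id (/-cong M P)
    (λ u v → /-cong M P ≈ᴹ-refl) (λ r u → /-cong M P ≈ᴹ-refl)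
    where open Module M

  infixr 9 _∘ᴴ_

  _∘ᴴ_ : {M : Module R m ℓm} {N : Module R m′ ℓm′} {Q : Module R m″ ℓm″} →
         Hom N Q → Hom M N → Hom M Q
  _∘ᴴ_ {M = M} {Q = Q} g f = mkHom M Q (⟦ g ⟧ ∘ ⟦ f ⟧)
    (Hom.⟦⟧-cong g ∘ Hom.⟦⟧-cong f)
    (λ u v → ≈ᴹ-trans (Hom.⟦⟧-cong g (Hom.+ᴹ-homo f u v)) (Hom.+ᴹ-homo g _ _))
    (λ r u → ≈ᴹ-trans (Hom.⟦⟧-cong g (Hom.*ₗ-homo f r u)) (Hom.*ₗ-homo g _ _))
    where open Module Q

  infix  8 -ᵗ_
  infixr 7 _*ᵗ_
  infixl 6 _+ᵗ_

  data Term (X : Set x) : Set (c ⊔ x) where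
    gen  : X → Term X
    0ᵗ   : Term X
    _+ᵗ_ : Term X → Term X → Term X
    -ᵗ_  : Term X → Term X
    _*ᵗ_ : Carrier → Term X → Term X

  -- The least module congruence on Term X containing Rl.
  data Cong {X : Set x} (Rl : Rel (Term X) ℓx) : Rel (Term X) (c ⊔ ℓ ⊔ x ⊔ ℓx) where
    rel       : ∀ {s t} → Rl s t → Cong Rl s t
    refl      : ∀ {s} → Cong Rl s s
    sym       : ∀ {s t} → Cong Rl s t → Cong Rl t s
    trans     : ∀ {s t u} → Cong Rl s t → Cong Rl t u → Cong Rl s u
    +-cong    : ∀ {s s′ t t′} → Cong Rl s s′ → Cong Rl t t′ → Cong Rl (s +ᵗ t) (s′ +ᵗ t′)
    *-cong    : ∀ {r r′ s s′} → r ≈ r′ → Cong Rl s s′ → Cong Rl (r *ᵗ s) (r′ *ᵗ s′)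
    neg-cong  : ∀ {s s′} → Cong Rl s s′ → Cong Rl (-ᵗ s) (-ᵗ s′)
    +-assoc   : ∀ s t u → Cong Rl ((s +ᵗ t) +ᵗ u) (s +ᵗ (t +ᵗ u))
    +-comm    : ∀ s t → Cong Rl (s +ᵗ t) (t +ᵗ s)
    +-idˡ     : ∀ s → Cong Rl (0ᵗ +ᵗ s) s
    +-invˡ    : ∀ s → Cong Rl (-ᵗ s +ᵗ s) 0ᵗ
    *-distˡ   : ∀ r s t → Cong Rl (r *ᵗ (s +ᵗ t)) (r *ᵗ s +ᵗ r *ᵗ t)
    *-distʳ   : ∀ r r′ s → Cong Rl ((r +ᴿ r′) *ᵗ s) (r *ᵗ s +ᵗ r′ *ᵗ s)
    *-assoc   : ∀ r r′ s → Cong Rl ((r *ᴿ r′) *ᵗ s) (r *ᵗ (r′ *ᵗ s))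
    *-idˡ     : ∀ s → Cong Rl (1# *ᵗ s) s
    *-zeroˡ   : ∀ s → Cong Rl (0# *ᵗ s) 0ᵗ
    *-zeroʳ   : ∀ r → Cong Rl (r *ᵗ 0ᵗ) 0ᵗ

  opaque
    Presented-isModule : (X : Set x) (Rl : Rel (Term X) ℓx) →
                         IsModule R (Cong Rl) _+ᵗ_ 0ᵗ -ᵗ_ _*ᵗ_ (flip _*ᵗ_)
    Presented-isModule X Rl = mkIsModule (Term X) (Cong Rl) _+ᵗ_ _*ᵗ_ 0ᵗ -ᵗ_
      record { refl = refl ; sym = sym ; trans = trans }
      +-cong *-cong neg-cong +-assoc +-comm +-idˡ +-invˡ
      *-distˡ *-distʳ *-assoc *-idˡ *-zeroˡ *-zeroʳ

  Presented : (X : Set x) → Rel (Term X) ℓx → Module R (c ⊔ x) (c ⊔ ℓ ⊔ x ⊔ ℓx)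
  Presented X Rl = record
    { Carrierᴹ = Term X ; _≈ᴹ_ = Cong Rl ; _+ᴹ_ = _+ᵗ_
    ; _*ₗ_ = _*ᵗ_ ; _*ᵣ_ = flip _*ᵗ_ ; 0ᴹ = 0ᵗ ; -ᴹ_ = -ᵗ_
    ; isModule = Presented-isModule X Rl
    }

  eval : {X : Set x} (N : Module R m ℓm) → (X → Module.Carrierᴹ N) →
         Term X → Module.Carrierᴹ N
  eval N f (gen v)  = f v
  eval N f 0ᵗ       = Module.0ᴹ N
  eval N f (s +ᵗ t) = Module._+ᴹ_ N (eval N f s) (eval N f t)
  eval N f (-ᵗ s)   = Module.-ᴹ_ N (eval N f s)
  eval N f (r *ᵗ s) = Module._*ₗ_ N r (eval N f s)

  Presented-lift : {X : Set x} {Rl : Rel (Term X) ℓx} (N : Module R m ℓm)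
                   (f : X → Module.Carrierᴹ N) →
                   (∀ {s t} → Rl s t → Module._≈ᴹ_ N (eval N f s) (eval N f t)) →
                   Hom (Presented X Rl) N
  Presented-lift {X = X} {Rl = Rl} N f f-rel =
    mkHom (Presented X Rl) N (eval N f) cong (λ _ _ → ≈ᴹ-refl) (λ _ _ → ≈ᴹ-refl)
    where
    open Module N
    cong : ∀ {s t} → Cong Rl s t → eval N f s ≈ᴹ eval N f t
    cong (rel h)           = f-rel h
    cong refl              = ≈ᴹ-refl
    cong (sym h)           = ≈ᴹ-sym (cong h)
    cong (trans h h′)      = ≈ᴹ-trans (cong h) (cong h′)
    cong (+-cong h h′)     = +ᴹ-cong (cong h) (cong h′)
    cong (*-cong eq h)     = *ₗ-cong eq (cong h)
    cong (neg-cong h)      = -ᴹ‿cong (cong h)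
    cong (+-assoc s t u)   = +ᴹ-assoc _ _ _
    cong (+-comm s t)      = +ᴹ-comm _ _
    cong (+-idˡ s)         = +ᴹ-identityˡ _
    cong (+-invˡ s)        = -ᴹ‿inverseˡ _
    cong (*-distˡ r s t)   = *ₗ-distribˡ r _ _
    cong (*-distʳ r r′ s)  = *ₗ-distribʳ _ r r′
    cong (*-assoc r r′ s)  = *ₗ-assoc r r′ _
    cong (*-idˡ s)         = *ₗ-identityˡ _
    cong (*-zeroˡ s)       = *ₗ-zeroˡ _
    cong (*-zeroʳ r)       = *ₗ-zeroʳ r

  data Multilinear {d} (M : Fin d → Module R m ℓm) :
         Rel (Term (∀ j → Module.Carrierᴹ (M j))) (c ⊔ m ⊔ ℓm) where
    ext : ∀ {u v} → (∀ j → Module._≈ᴹ_ (M j) (u j) (v j)) →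
          Multilinear M (gen u) (gen v)
    add : ∀ i {u v w} →
          Module._≈ᴹ_ (M i) (u i) (Module._+ᴹ_ (M i) (v i) (w i)) →
          (∀ j → j ≢ i → Module._≈ᴹ_ (M j) (u j) (v j) × Module._≈ᴹ_ (M j) (u j) (w j)) →
          Multilinear M (gen u) (gen v +ᵗ gen w)
    mul : ∀ i r {u v} →
          Module._≈ᴹ_ (M i) (u i) (Module._*ₗ_ (M i) r (v i)) →
          (∀ j → j ≢ i → Module._≈ᴹ_ (M j) (u j) (v j)) →
          Multilinear M (gen u) (r *ᵗ gen v)

  data Alternating (M : Module R m ℓm) (d : ℕ) :
         Rel (Term (Vector (Module.Carrierᴹ M) d)) (c ⊔ m ⊔ ℓm) where
    multilinear : ∀ {s t} → Multilinear (λ _ → M) s t → Alternating M d s t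
    alternating : ∀ {i j v} → i ≢ j → Module._≈ᴹ_ M (v i) (v j) →
                  Alternating M d (gen v) 0ᵗ

  ⨂ : ∀ {d} → (Fin d → Module R m ℓm) → Module R (c ⊔ m) (c ⊔ ℓ ⊔ m ⊔ ℓm)
  ⨂ M = Presented (∀ j → Module.Carrierᴹ (M j)) (Multilinear M)

  ⋀ : ℕ → Module R m ℓm → Module R (c ⊔ m) (c ⊔ ℓ ⊔ m ⊔ ℓm)
  ⋀ d M = Presented (Vector (Module.Carrierᴹ M) d) (Alternating M d)

  ⨂-map : ∀ {d} {M : Fin d → Module R m ℓm} {N : Fin d → Module R m′ ℓm′} →
          (∀ j → Hom (M j) (N j)) → Hom (⨂ M) (⨂ N)
  ⨂-map {M = M} {N = N} f = Presented-lift (⨂ N) (λ v → gen (λ j → ⟦ f j ⟧ (v j))) λ where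
      (ext h)       → rel (ext λ j → Hom.⟦⟧-cong (f j) (h j))
      (add i h h′)  → rel (add i
        (Module.≈ᴹ-trans (N i) (Hom.⟦⟧-cong (f i) h) (Hom.+ᴹ-homo (f i) _ _))
        (λ j j≢i → Hom.⟦⟧-cong (f j) (proj₁ (h′ j j≢i)) , Hom.⟦⟧-cong (f j) (proj₂ (h′ j j≢i))))
      (mul i r h h′) → rel (mul i r
        (Module.≈ᴹ-trans (N i) (Hom.⟦⟧-cong (f i) h) (Hom.*ₗ-homo (f i) _ _))
        (λ j j≢i → Hom.⟦⟧-cong (f j) (h′ j j≢i)))

  ⨂-map-∘ : ∀ {d} {M : Fin d → Module R m ℓm} {N : Fin d → Module R m′ ℓm′}
            {Q : Fin d → Module R m″ ℓm″}
            (g : ∀ j → Hom (N j) (Q j)) (f : ∀ j → Hom (M j) (N j)) (h : ∀ j → Hom (M j) (Q j)) →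
            (∀ j u → Module._≈ᴹ_ (Q j) (⟦ g j ⟧ (⟦ f j ⟧ u)) (⟦ h j ⟧ u)) →
            ∀ t → Module._≈ᴹ_ (⨂ Q) (⟦ ⨂-map {M = N} {N = Q} g ⟧ (⟦ ⨂-map {M = M} {N = N} f ⟧ t))
                                    (⟦ ⨂-map {M = M} {N = Q} h ⟧ t)
  ⨂-map-∘ {M = M} {N = N} {Q = Q} g f h gf≈h = go
    where
    go : ∀ t → Cong (Multilinear Q)
               (eval (⨂ Q) (λ v → gen (λ j → ⟦ g j ⟧ (v j)))
                 (eval (⨂ N) (λ v → gen (λ j → ⟦ f j ⟧ (v j))) t))
               (eval (⨂ Q) (λ v → gen (λ j → ⟦ h j ⟧ (v j))) t)
    go (gen v)  = rel (ext λ j → gf≈h j (v j))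
    go 0ᵗ       = refl
    go (s +ᵗ t) = +-cong (go s) (go t)
    go (-ᵗ s)   = neg-cong (go s)
    go (r *ᵗ s) = *-cong (CommutativeRing.refl R) (go s)

  record IsBasis (E : Module R e ℓe) {n} (z : Vector (Module.Carrierᴹ E) n)
                 : Set (c ⊔ ℓ ⊔ e ⊔ ℓe) where
    open Module E
    combination : Vector Carrier n → Carrierᴹ
    combination r = RawMonoidDefs.sum +ᴹ-rawMonoid (λ i → r i *ₗ z i)
    field
      spanning    : ∀ v → ∃[ r ] combination r ≈ᴹ v
      independent : ∀ r → combination r ≈ᴹ 0ᴹ → ∀ i → r i ≈ 0#

-- A monomial in the variables z_pq, 1 ≤ p,q ≤ n; entry (p , q) is the exponent of z_pq.
Monomial : ℕ → Set
Monomial n = Vec (Vec ℕ n) n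

_·_ : ∀ {n} → Monomial n → Monomial n → Monomial n
_·_ = Vec.zipWith (Vec.zipWith ℕ._+_)

_≟ᴹ_ : ∀ {n} → DecidableEquality (Monomial n)
_≟ᴹ_ = Vec.≡-dec (Vec.≡-dec ℕ._≟_)

module _ {c ℓ} (R : CommutativeRing c ℓ) (n : ℕ) where

  open CommutativeRing R using (Carrier; _≈_; _+_; _*_; -_; 0#; 1#)

  -- Finite lists of terms (coefficient , monomial), in which a monomial may occur repeatedly.
  Polynomial : Set c
  Polynomial = List (Carrier × Monomial n)

  coefficient : Polynomial → Monomial n → Carrier
  coefficient []            μ = 0#
  coefficient ((r , ν) ∷ f) μ = (if does (ν ≟ᴹ μ) then r else 0#) + coefficient f μ

  polynomialRing : RawRing c ℓ
  polynomialRing = record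
    { Carrier = Polynomial
    ; _≈_ = λ f g → ∀ μ → coefficient f μ ≈ coefficient g μ
    ; _+_ = _++_
    ; _*_ = List.cartesianProductWith λ (r , μ) (s , ν) → r * s , μ · ν
    ; -_ = List.map λ (r , μ) → - r , μ
    ; 0# = []
    ; 1# = (1# , Vec.replicate n (Vec.replicate n 0)) ∷ []
    }

  scale : Carrier → Polynomial → Polynomial
  scale r = List.map λ (s , μ) → r * s , μ

  variable-z : Fin n → Fin n → Polynomial
  variable-z p q = (1# , Vec.tabulate λ i → Vec.tabulate λ j →
                     if does (i Fin.≟ p) ∧ does (j Fin.≟ q) then 1 else 0) ∷ []

module _ {s ℓs} (S : RawRing s ℓs) where

  open RawRing S
  open RawSemiringDefs rawSemiring using (sum; _^_)

  -- Laplace expansion along the first row.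
  det : ∀ {d} → (Fin d → Fin d → Carrier) → Carrier
  det {zero}  A = 1#
  det {suc d} A = sum λ j →
    (- 1#) ^ toℕ j * (A Fin.zero j * det λ p q → A (Fin.suc p) (punchIn j q))

-- A subset {b_1 < ⋯ < b_d} of {1,…,n}.
record Increasing (d n : ℕ) : Set where
  field
    at         : Fin d → Fin n
    increasing : ∀ {s t} → s Fin.< t → at s Fin.< at t

open Increasing public using (at)

module _ {c ℓ} {R : CommutativeRing c ℓ} (E : Module R e ℓe) where

  open CommutativeRing R using (Carrier)
  private
    module E = Module E

  -- The quotients are F_n → ⋯ → F_1, with F_{row i} at index i : Fin n; step contains the
  -- composites of the maps F_{i+1} → F_i.
  record Flag (n : ℕ) (o ℓo : Level) : Set (c ⊔ ℓ ⊔ e ⊔ ℓe ⊔ lsuc (o ⊔ ℓo)) where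
    field
      obj             : Fin n → Module R o ℓo
      proj            : ∀ i → Hom E (obj i)
      proj-surjective : ∀ i → Surjective E._≈ᴹ_ (Module._≈ᴹ_ (obj i)) ⟦ proj i ⟧
      step            : ∀ {i j} → i Fin.≤ j → Hom (obj j) (obj i)
      step-proj       : ∀ {i j} (i≤j : i Fin.≤ j) v →
                        Module._≈ᴹ_ (obj i) (⟦ step i≤j ⟧ (⟦ proj j ⟧ v)) (⟦ proj i ⟧ v)

  -- Compatibility with the maps F_j → F_i follows from surjectivity of E → F_j.
  record FlagHom {n} (F : Flag n o ℓo) (G : Flag n o′ ℓo′)
                 : Set (c ⊔ ℓ ⊔ e ⊔ ℓe ⊔ o ⊔ ℓo ⊔ o′ ⊔ ℓo′) where
    private
      module F = Flag F
      module G = Flag G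
    field
      map      : ∀ i → Hom (F.obj i) (G.obj i)
      map-proj : ∀ i v → Module._≈ᴹ_ (G.obj i) (⟦ map i ⟧ (⟦ F.proj i ⟧ v)) (⟦ G.proj i ⟧ v)

  module _ {n} (F : Flag n o ℓo) where

    open Flag F

    -- With s running over 0,…,d-1, the vectors in positions s+1,…,d of the wedge lie in
    -- ker(E → F_{a_{s+1}}).  These wedges span the sum of the images of
    -- ⋀^s E ⊗ ⋀^{d-s} ker(E → F_{a_{s+1}}) in ⋀^d E.
    FlagRelation : ∀ {d} → Vector (Fin n) d → Pred (Module.Carrierᴹ (⋀ d E)) _
    FlagRelation {d} a x = ∃[ s ] Σ[ v ∈ Vector E.Carrierᴹ d ]
      (∀ t → s Fin.≤ t → Ker (proj (a s)) (v t)) × Module._≈ᴹ_ (⋀ d E) x (gen v)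

    columnModule : ∀ {d} → Vector (Fin n) d → Module R _ _
    columnModule {d} a = ⋀ d E / FlagRelation a

  module _ {n} (z : Vector E.Carrierᴹ n) {d} (D : Diagram d) (D≤n : InRows n D) where

    private
      a : ∀ j → Vector (Fin n) (size (D j))
      a j = boxRow (D j) (D≤n j)

    TE : Module R _ _
    TE = ⨂ λ j → ⋀ (size (D j)) E

    Tableau : Set
    Tableau = ∀ j → Increasing (size (D j)) n

    z[_] : Tableau → Module.Carrierᴹ TE
    z[ τ ] = gen λ j → gen λ s → z (at (τ j) s)

    minorProduct : Tableau → Polynomial R n
    minorProduct τ = product λ j → det P λ s t → variable-z R n (a j s) (at (τ j) t)
      where
      P : RawRing c ℓ
      P = polynomialRing R n
      open RawSemiringDefs (RawRing.rawSemiring P) using (product)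

    sumTE : List (Carrier × Tableau) → Module.Carrierᴹ TE
    sumTE []            = 0ᵗ
    sumTE ((r , τ) ∷ l) = r *ᵗ z[ τ ] +ᵗ sumTE l

    sumMinors : List (Carrier × Tableau) → Polynomial R n
    sumMinors []            = []
    sumMinors ((r , τ) ∷ l) = scale R n r (minorProduct τ) ++ sumMinors l

    -- The z[ τ ] form a basis of TE when z is a basis of E.  So x = Σ r z[ τ ] lies in the
    -- kernel of the linear map z[ τ ] ↦ minorProduct τ iff Σ r minorProduct τ = 0.
    Exchange : Pred (Module.Carrierᴹ TE) _
    Exchange x = ∃[ l ] Module._≈ᴹ_ TE x (sumTE l) ×
                        RawRing._≈_ (polynomialRing R n) (sumMinors l) []

    module _ (F : Flag n o ℓo) where

      TF : Module R _ _
      TF = ⨂ λ j → columnModule F (a j)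

      TE→TF : Hom TE TF
      TE→TF = ⨂-map {M = λ j → ⋀ (size (D j)) E} {N = λ j → columnModule F (a j)}
        λ j → /-proj (⋀ (size (D j)) E) (FlagRelation F (a j))

      ExchangeImage : Pred (Module.Carrierᴹ TF) _
      ExchangeImage y = ∃[ x ] Exchange x × Module._≈ᴹ_ TF y (⟦ TE→TF ⟧ x)

      SchurModule : Module R _ _
      SchurModule = TF / ExchangeImage

    module _ {F : Flag n o ℓo} {G : Flag n o′ ℓo′} (f : FlagHom F G) where

      private
        module F = Flag F
        module G = Flag G

      columnMap : ∀ {r} (b : Vector (Fin n) r) → Hom (columnModule F b) (columnModule G b)
      columnMap {r} b = /-lift {M = ⋀ r E} {N = columnModule G b} (/-proj (⋀ r E) (FlagRelation G b))
        λ (s , v , v∈ker , x≈v) → /-incl (⋀ r E) (FlagRelation G b) (incl (s , v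
          , (λ t s≤t → let open Module (G.obj (b s)) in
              ≈ᴹ-trans (≈ᴹ-sym (FlagHom.map-proj f (b s) (v t)))
                (≈ᴹ-trans (Hom.⟦⟧-cong (FlagHom.map f (b s)) (v∈ker t s≤t))
                  (Hom.0ᴹ-homo (FlagHom.map f (b s)))))
          , x≈v))

      TMap : Hom (TF F) (TF G)
      TMap = ⨂-map {M = λ j → columnModule F (a j)} {N = λ j → columnModule G (a j)}
        λ j → columnMap (a j)

      schurMap : Hom (SchurModule F) (SchurModule G)
      schurMap = /-lift {M = TF F} {N = SchurModule G}
        (_∘ᴴ_ {M = TF F} {N = TF G} {Q = SchurModule G} (/-proj (TF G) (ExchangeImage G)) TMap)
        λ {y} (x , x∈Exchange , y≈x) → /-incl (TF G) (ExchangeImage G)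
          (incl (x , x∈Exchange , Module.≈ᴹ-trans (TF G) (Hom.⟦⟧-cong TMap y≈x)
            (⨂-map-∘ {M = λ j → ⋀ (size (D j)) E} {N = λ j → columnModule F (a j)}
              {Q = λ j → columnModule G (a j)}
              (λ j → columnMap (a j))
              (λ j → /-proj (⋀ (size (D j)) E) (FlagRelation F (a j)))
              (λ j → /-proj (⋀ (size (D j)) E) (FlagRelation G (a j)))
              (λ j u → Module.≈ᴹ-refl (columnModule G (a j))) x)))

  module _ {n} (z : Vector E.Carrierᴹ n) where

    -- E_i = E / ⟨z_{i+1},…,z_n⟩; the basis vector z j is the mathematical z_{row j}.
    E[_] : ℕ → Module R _ _
    E[ i ] = E / λ v → ∃[ j ] i < row j × v E.≈ᴹ z j

    E-proj : ∀ i → Hom E E[ i ]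
    E-proj i = /-proj E _

    E-step : ∀ {i j} → i ≤ j → Hom E[ j ] E[ i ]
    E-step {i} i≤j = /-lift {N = E[ i ]} (E-proj i)
      λ (l , j<l , v≈z) → /-incl E _ (incl (l , ℕ.≤-<-trans i≤j j<l , v≈z))

    reindex : (ρ : ℕ → ℕ) → (∀ {i j} → i ≤ j → ρ i ≤ ρ j) → Flag n _ _
    reindex ρ ρ-mono = record
      { obj = λ i → E[ ρ (row i) ]
      ; proj = λ i → E-proj (ρ (row i))
      ; proj-surjective = λ i v → v , /-cong E _
      ; step = λ i≤j → E-step (ρ-mono (ℕ.s≤s i≤j))
      ; step-proj = λ {i} _ v → Module.≈ᴹ-refl E[ ρ (row i) ]
      }

    standardFlag : Flag n _ _
    standardFlag = reindex id id

    shift : ℕ → ℕ → ℕ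
    shift k i with i ℕ.<? k
    ... | yes _ = i
    ... | no  _ = pred i

    shift-mono : ∀ k {i j} → i ≤ j → shift k i ≤ shift k j
    shift-mono k {i} {j} i≤j with i ℕ.<? k | j ℕ.<? k
    ... | yes _   | yes _   = i≤j
    ... | yes i<k | no  j≮k = ℕ.<⇒≤pred (ℕ.<-≤-trans i<k (ℕ.≮⇒≥ j≮k))
    ... | no  i≮k | yes j<k = ⊥-elim (i≮k (ℕ.≤-<-trans i≤j j<k))
    ... | no  _   | no  _   = ℕ.pred-mono-≤ i≤j

    𝖱 : ℕ → Flag n _ _
    𝖱 k = reindex (shift k) (shift-mono k)

    shift-suc : ∀ k i → shift k i ≤ shift (suc k) i
    shift-suc k i with i ℕ.<? k | i ℕ.<? suc k
    ... | yes _   | yes _    = ℕ.≤-refl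
    ... | yes i<k | no  i≮sk = ⊥-elim (i≮sk (ℕ.m<n⇒m<1+n i<k))
    ... | no  _   | yes _    = ℕ.pred[n]≤n
    ... | no  _   | no  _    = ℕ.≤-refl

    -- The projection E_k → E_{k-1} in position k; in every other position the source and
    -- target agree and, E-step being the identity on representatives, the map is the identity.
    𝖱-step : ∀ k → FlagHom (𝖱 (suc k)) (𝖱 k)
    𝖱-step k = record
      { map = λ i → E-step (shift-suc k (row i))
      ; map-proj = λ i v → Module.≈ᴹ-refl E[ shift k (row i) ]
      }

{-# OPTIONS --safe #-}
-- Two vectors congruent to a multiple of a fixed ζ modulo a submodule contribute at most one factor ζ
-- to a wedge.  When k and k+1 both lie in a column, a relation of 𝖱_k at the box k therefore leaves
-- at most one factor z_k among its last vectors; after that factor is moved to the box k, the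
-- relation of 𝖱_{k+1} at the box k+1 applies.  So the column modules, and with them the Schur
-- modules, have the same relations, and the identity on representatives is the inverse map.
module Submission where

open import Defs
open import Algebra.Bundles using (AbelianGroup; CommutativeRing)
open import Algebra.Module.Bundles using (Module)
import Algebra.Properties.AbelianGroup as AbelianGroupProperties
import Algebra.Properties.CommutativeSemigroup as CommutativeSemigroupProperties
open import Data.Empty using (⊥-elim)
open import Data.Fin.Base as Fin using (Fin; toℕ; fromℕ<)
import Data.Fin.Properties as Fin
open import Data.Nat.Base as ℕ using (ℕ; zero; suc; pred; _≤_; _<_)
import Data.Nat.Properties as ℕ
open import Data.Product.Base using (∃-syntax; _×_; _,_)
open import Data.Vec.Functional using (Vector; updateAt)
open import Data.Vec.Functional.Properties using (updateAt-updates; updateAt-minimal)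
open import Function.Base using (const; _∘_)
open import Level using (Level)
open import Relation.Binary.Definitions using (tri<; tri≈; tri>)
open import Relation.Binary.PropositionalEquality as ≡ using (_≡_; _≢_; refl)
open import Relation.Nullary.Decidable.Core using (yes; no)
open import Relation.Unary using (Pred)

private
  variable
    c ℓ e ℓe o o′ ℓo ℓo′ p q : Level

-- Vectors with one entry replaced.

infixl 10 _[_≔_]

_[_≔_] : ∀ {A : Set e} {d} → Vector A d → Fin d → A → Vector A d
v [ i ≔ x ] = updateAt v i (const x)

module _ {A : Set e} {d} (v : Vector A d) {i : Fin d} {x : A} where

  at-updated : (v [ i ≔ x ]) i ≡ x
  at-updated = updateAt-updates i v

  at-other : ∀ {j} → j ≢ i → (v [ i ≔ x ]) j ≡ v j
  at-other j≢i = updateAt-minimal _ i v j≢i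

  updated-all : ∀ {P : Fin d → Pred A q} →
                P i x → (∀ j → j ≢ i → P j (v j)) → ∀ j → P j ((v [ i ≔ x ]) j)
  updated-all {P = P} Px Pv j with j Fin.≟ i
  ... | yes refl = ≡.subst (P i) (≡.sym at-updated) Px
  ... | no  j≢i  = ≡.subst (P j) (≡.sym (at-other j≢i)) (Pv j j≢i)

-- Membership in a line plus a submodule.

module _ {R : CommutativeRing c ℓ} (E : Module R e ℓe) where

  private
    module R = CommutativeRing R
  open Module E
  open AbelianGroupProperties +ᴹ-abelianGroup using (⁻¹-∙-comm; inverseˡ-unique; ε⁻¹≈ε)
  open CommutativeSemigroupProperties
    (AbelianGroup.commutativeSemigroup +ᴹ-abelianGroup) using (interchange)

  /-zero⇒Span : (P : Pred Carrierᴹ p) → ∀ {u} → Module._≈ᴹ_ (E / P) u 0ᴹ → Span E P u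
  /-zero⇒Span P {u} = resp (≈ᴹ-trans (+ᴹ-congˡ ε⁻¹≈ε) (+ᴹ-identityʳ u))

  LineMod : Pred Carrierᴹ q → Carrierᴹ → Pred Carrierᴹ _
  LineMod K ζ x = ∃[ r ] ∃[ w ] x ≈ᴹ r *ₗ ζ +ᴹ w × K w

  -ᴹ‿*ₗ : ∀ r u → -ᴹ (r *ₗ u) ≈ᴹ (R.- r) *ₗ u
  -ᴹ‿*ₗ r u = ≈ᴹ-sym (inverseˡ-unique _ _
    (≈ᴹ-trans (≈ᴹ-sym (*ₗ-distribʳ u (R.- r) r))
      (≈ᴹ-trans (*ₗ-congʳ (R.-‿inverseˡ r)) (*ₗ-zeroˡ u))))

  1x+ : ∀ x y → x +ᴹ y ≈ᴹ R.1# *ₗ x +ᴹ y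
  1x+ x y = +ᴹ-congʳ (≈ᴹ-sym (*ₗ-identityˡ x))

  module _ {K : Pred Carrierᴹ q} {ζ : Carrierᴹ} where

    K⇒LineMod : ∀ {w} → K w → LineMod K ζ w
    K⇒LineMod {w} Kw =
      R.0# , w , ≈ᴹ-sym (≈ᴹ-trans (+ᴹ-congʳ (*ₗ-zeroˡ ζ)) (+ᴹ-identityˡ w)) , Kw

    ζ+LineMod : ∀ {x} → LineMod K ζ x → LineMod K ζ (ζ +ᴹ x)
    ζ+LineMod (r , w , x≈ , Kw) = R.1# R.+ r , w ,
      ≈ᴹ-trans (+ᴹ-cong (≈ᴹ-sym (*ₗ-identityˡ ζ)) x≈)
        (≈ᴹ-trans (≈ᴹ-sym (+ᴹ-assoc _ _ _)) (+ᴹ-congʳ (≈ᴹ-sym (*ₗ-distribʳ ζ R.1# r)))) , Kw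

  -- The vectors in `LineMod (Span E Q) ζ` form a submodule, so it suffices to test generators.
  Span⊆LineMod : ∀ {P : Pred Carrierᴹ p} {Q : Pred Carrierᴹ q} {ζ} →
                 (∀ {u} → P u → LineMod (Span E Q) ζ u) → ∀ {u} → Span E P u → LineMod (Span E Q) ζ u
  Span⊆LineMod P⊆ (incl h) = P⊆ h
  Span⊆LineMod P⊆ zero = K⇒LineMod zero
  Span⊆LineMod {ζ = ζ} P⊆ (add h h′) with Span⊆LineMod P⊆ h | Span⊆LineMod P⊆ h′
  ... | r , w , u≈ , Qw | r′ , w′ , u′≈ , Qw′ = r R.+ r′ , w +ᴹ w′ ,
    ≈ᴹ-trans (+ᴹ-cong u≈ u′≈)
      (≈ᴹ-trans (interchange _ _ _ _) (+ᴹ-congʳ (≈ᴹ-sym (*ₗ-distribʳ ζ r r′)))) , add Qw Qw′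
  Span⊆LineMod {ζ = ζ} P⊆ (neg h) with Span⊆LineMod P⊆ h
  ... | r , w , u≈ , Qw = R.- r , -ᴹ w ,
    ≈ᴹ-trans (-ᴹ‿cong u≈)
      (≈ᴹ-trans (≈ᴹ-sym (⁻¹-∙-comm _ _)) (+ᴹ-congʳ (-ᴹ‿*ₗ r ζ))) , neg Qw
  Span⊆LineMod {ζ = ζ} P⊆ (mul s h) with Span⊆LineMod P⊆ h
  ... | r , w , u≈ , Qw = s R.* r , s *ₗ w ,
    ≈ᴹ-trans (*ₗ-congˡ u≈)
      (≈ᴹ-trans (*ₗ-distribˡ s _ _) (+ᴹ-congʳ (≈ᴹ-sym (*ₗ-assoc s r ζ)))) , mul s Qw
  Span⊆LineMod P⊆ (resp u≈u′ h) with Span⊆LineMod P⊆ h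
  ... | r , w , u≈ , Qw = r , w , ≈ᴹ-trans (≈ᴹ-sym u≈u′) u≈ , Qw

-- Vanishing wedges in a quotient of an exterior power.

module _ {R : CommutativeRing c ℓ} (E : Module R e ℓe) {d} (P : Pred (Module.Carrierᴹ (⋀ d E)) p) where

  private
    open Module E
    module N = Module (⋀ d E / P)

  Null : Vector Carrierᴹ d → Set _
  Null v = gen v N.≈ᴹ N.0ᴹ

  wedge-cong : ∀ {v w} → (∀ i → v i ≈ᴹ w i) → gen v N.≈ᴹ gen w
  wedge-cong v≈w = /-cong (⋀ d E) P (rel (multilinear (ext v≈w)))

  null-repeated : ∀ {v i j} → i ≢ j → v i ≈ᴹ v j → Null v
  null-repeated i≢j vᵢ≈vⱼ = /-cong (⋀ d E) P (rel (alternating i≢j vᵢ≈vⱼ))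

  -- Multilinearity in position `i`: the term with `r *ₗ x` there is `r` times a null wedge, and
  -- only the term with `y` survives.
  drop-summand : ∀ {v} i {r x y} → v i ≈ᴹ r *ₗ x +ᴹ y →
                 Null (v [ i ≔ x ]) → gen v N.≈ᴹ gen (v [ i ≔ y ])
  drop-summand {v} i {r} {x} {y} vᵢ≈ x-null =
    N.≈ᴹ-trans (/-cong (⋀ d E) P (rel (multilinear (add i {v} {v [ i ≔ r *ₗ x ]} {v [ i ≔ y ]}
        (≈ᴹ-trans vᵢ≈ (+ᴹ-cong (≈ᴹ-reflexive (≡.sym (at-updated v))) (≈ᴹ-reflexive (≡.sym (at-updated v)))))
        λ j j≢i → other j≢i , other j≢i))))
      (N.≈ᴹ-trans (N.+ᴹ-congʳ rx-null) (N.+ᴹ-identityˡ _))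
    where
    other : ∀ {j u} → j ≢ i → v j ≈ᴹ (v [ i ≔ u ]) j
    other j≢i = ≈ᴹ-reflexive (≡.sym (at-other v j≢i))

    rx-null : Null (v [ i ≔ r *ₗ x ])
    rx-null = N.≈ᴹ-trans
      (/-cong (⋀ d E) P (rel (multilinear (mul i r {v [ i ≔ r *ₗ x ]} {v [ i ≔ x ]}
        (≈ᴹ-trans (≈ᴹ-reflexive (at-updated v)) (*ₗ-congˡ (≈ᴹ-reflexive (≡.sym (at-updated v)))))
        λ j j≢i → ≈ᴹ-trans (≈ᴹ-sym (other j≢i)) (other j≢i)))))
      (N.≈ᴹ-trans (N.*ₗ-congˡ x-null) (N.*ₗ-zeroʳ r))

  -- Descending induction over the positions. `A` is an invariant and `Q` the normal form of an
  -- entry; since `normalise` alters a single entry and preserves `A`, entries already in normal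
  -- form stay so.
  null-by-positions :
    ∀ {q q′} (A : Pred (Vector Carrierᴹ d) q) (Q : Fin d → Pred Carrierᴹ q′) →
    (∀ i v → A v → ∃[ w ] Q i (w i) × (∀ j → j ≢ i → w j ≡ v j) × A w × gen v N.≈ᴹ gen w) →
    (∀ v → A v → (∀ i → Q i (v i)) → Null v) →
    ∀ v → A v → Null v
  null-by-positions A Q normalise null-normal v Av =
    go d ℕ.≤-refl v Av λ i d≤i → ⊥-elim (ℕ.<⇒≱ (Fin.toℕ<n i) d≤i)
    where
    -- The positions from `b` on are in normal form; the start `b = d` asks for none.
    go : ∀ b → b ≤ d → ∀ v → A v → (∀ i → b ≤ toℕ i → Q i (v i)) → Null v
    go zero    _   v Av Qv = null-normal v Av λ i → Qv i ℕ.z≤n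
    go (suc b) b<d v Av Qv with normalise (fromℕ< b<d) v Av
    ... | w , Qw , w≡v , Aw , v≈w = N.≈ᴹ-trans v≈w (go b (ℕ.<⇒≤ b<d) w Aw Qw′)
      where
      Qw′ : ∀ i → b ≤ toℕ i → Q i (w i)
      -- Either `i` is the position just treated, or it lies strictly beyond `b` and its entry is
      -- untouched.
      Qw′ i b≤i with i Fin.≟ fromℕ< b<d
      ... | yes refl = Qw
      ... | no  i≢b  = ≡.subst (Q i) (≡.sym (w≡v i i≢b)) (Qv i (ℕ.≤∧≢⇒< b≤i
        λ b≡i → i≢b (Fin.toℕ-injective (≡.trans (≡.sym b≡i) (≡.sym (Fin.toℕ-fromℕ< b<d))))))

  -- Wedges whose last entries lie in a line modulo `K`.

  module _ (K : Pred Carrierᴹ q) (ζ : Carrierᴹ) where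

    private
      Line : Pred Carrierᴹ _
      Line = LineMod E K ζ

    module _ {s : Fin d} (null-K : ∀ v → (∀ t → s Fin.< t → K (v t)) → Null v) where

      -- The `ζ` part of a later entry repeats the `ζ` in position `s` and drops out. What remains
      -- has all later entries in `K`, so `null-K` finishes.
      null-leading : ∀ v → v s ≈ᴹ ζ × (∀ t → s Fin.< t → Line (v t)) → Null v
      null-leading = null-by-positions _ (λ t x → s Fin.< t → K x) normalise
        λ v _ Kv → null-K v Kv
        where
        normalise : ∀ t v → v s ≈ᴹ ζ × (∀ u → s Fin.< u → Line (v u)) →
                    ∃[ v′ ] (s Fin.< t → K (v′ t)) × (∀ u → u ≢ t → v′ u ≡ v u) ×
                    (v′ s ≈ᴹ ζ × (∀ u → s Fin.< u → Line (v′ u))) × gen v N.≈ᴹ gen v′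
        normalise t v (vₛ≈ζ , line) with s Fin.<? t
        ... | no  s≮t = v , (⊥-elim ∘ s≮t) , (λ _ _ → refl) , (vₛ≈ζ , line) , N.≈ᴹ-refl
        ... | yes s<t with line t s<t
        ... | r , w , vₜ≈ , Kw = v [ t ≔ w ]
            , (λ _ → ≡.subst K (≡.sym (at-updated v)) Kw)
            , (λ _ → at-other v)
            , ( ≈ᴹ-trans (≈ᴹ-reflexive (at-other v s≢t)) vₛ≈ζ
              , updated-all v {P = λ u x → s Fin.< u → Line x} (λ _ → K⇒LineMod E Kw) (λ u _ → line u))
            , drop-summand t vₜ≈ (null-repeated s≢t
                (≈ᴹ-trans (≈ᴹ-reflexive (at-other v s≢t))
                  (≈ᴹ-trans vₛ≈ζ (≈ᴹ-reflexive (≡.sym (at-updated v))))))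
          where
          s≢t : s ≢ t
          s≢t = Fin.<⇒≢ s<t

      -- With x in position s and ζ in position t, the wedge equals the one with ζ + x in both:
      -- expand position t, then position s, where the new term has ζ in position s.
      null-containing : ∀ {t} → s Fin.≤ t → ∀ v → (∀ u → s Fin.≤ u → Line (v u)) →
                        Null (v [ t ≔ ζ ])
      null-containing {t} s≤t v line with s Fin.≟ t
      ... | yes refl = null-leading (v [ s ≔ ζ ])
              ( ≈ᴹ-reflexive (at-updated v)
              , λ u s<u → ≡.subst Line (≡.sym (at-other v (Fin.<⇒≢ s<u ∘ ≡.sym))) (line u (ℕ.<⇒≤ s<u)))
      ... | no s≢t = N.≈ᴹ-trans (N.≈ᴹ-sym vₜ-ζ) (N.≈ᴹ-trans (N.≈ᴹ-sym vₛ-x) both-null)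
        where
        x y : Carrierᴹ
        x = v s
        y = ζ +ᴹ x

        one both : Vector Carrierᴹ d
        one  = v [ t ≔ y ]
        both = one [ s ≔ y ]

        t≢s : t ≢ s
        t≢s = s≢t ∘ ≡.sym

        both-null : Null both
        both-null = null-repeated s≢t (≈ᴹ-reflexive
          (≡.trans (at-updated one) (≡.sym (≡.trans (at-other one t≢s) (at-updated v)))))

        vₛ-x : gen both N.≈ᴹ gen one
        vₛ-x = N.≈ᴹ-trans
          (drop-summand s (≈ᴹ-trans (≈ᴹ-reflexive (at-updated one)) (1x+ E ζ x))
            (null-leading (both [ s ≔ ζ ])
              ( ≈ᴹ-reflexive (at-updated both)
              , λ u s<u → ≡.subst Line
                  (≡.sym (≡.trans (at-other both (Fin.<⇒≢ s<u ∘ ≡.sym)) (at-other one (Fin.<⇒≢ s<u ∘ ≡.sym))))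
                  (updated-all v {i = t} {x = y} {P = λ u z → s Fin.≤ u → Line z}
                    -- The entry in position `t` is `ζ +ᴹ x`; it stays in `Line` because `x` is the
                    -- entry `v s`.
                    (λ _ → ζ+LineMod E (line s ℕ.≤-refl)) (λ u _ → line u) u (ℕ.<⇒≤ s<u)))))
          (wedge-cong (updated-all both {P = λ u z → z ≈ᴹ one u}
            (≈ᴹ-reflexive (≡.sym (at-other v s≢t)))
            (λ u u≢s → ≈ᴹ-reflexive (at-other one u≢s))))

        vₜ-ζ : gen one N.≈ᴹ gen (v [ t ≔ ζ ])
        vₜ-ζ = N.≈ᴹ-trans
          (drop-summand t (≈ᴹ-trans (≈ᴹ-reflexive (at-updated v)) (≈ᴹ-trans (+ᴹ-comm ζ x) (1x+ E x ζ)))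
            (null-repeated s≢t (≈ᴹ-reflexive
              (≡.trans (at-other one s≢t) (≡.trans (at-other v s≢t) (≡.sym (at-updated one)))))))
          (wedge-cong (updated-all one {P = λ u z → z ≈ᴹ (v [ t ≔ ζ ]) u}
            (≈ᴹ-reflexive (≡.sym (at-updated v)))
            (λ u u≢t → ≈ᴹ-reflexive (≡.trans (at-other v u≢t) (≡.sym (at-other v u≢t))))))

      -- Each entry from `s` on splits into a multiple of `ζ` and a part in `K`. The first gives a
      -- null wedge by `null-containing`, so all these entries may be taken in `K`, where `null-K`
      -- applies.
      null-LineMod : ∀ v → (∀ t → s Fin.≤ t → Line (v t)) → Null v
      null-LineMod = null-by-positions _ (λ t x → s Fin.≤ t → K x) normalise
        λ v _ Kv → null-K v λ t s<t → Kv t (ℕ.<⇒≤ s<t)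
        where
        normalise : ∀ t v → (∀ u → s Fin.≤ u → Line (v u)) →
                    ∃[ v′ ] (s Fin.≤ t → K (v′ t)) × (∀ u → u ≢ t → v′ u ≡ v u) ×
                    (∀ u → s Fin.≤ u → Line (v′ u)) × gen v N.≈ᴹ gen v′
        normalise t v line with s Fin.≤? t
        ... | no  s≰t = v , (⊥-elim ∘ s≰t) , (λ _ _ → refl) , line , N.≈ᴹ-refl
        ... | yes s≤t with line t s≤t
        ... | r , w , vₜ≈ , Kw = v [ t ≔ w ]
            , (λ _ → ≡.subst K (≡.sym (at-updated v)) Kw)
            , (λ _ → at-other v)
            , updated-all v {P = λ u x → s Fin.≤ u → Line x} (λ _ → K⇒LineMod E Kw) (λ u _ → line u)
            , drop-summand t vₜ≈ (null-containing s≤t v line)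


-- Inverting the map of Schur modules.

module _ {R : CommutativeRing c ℓ} {E : Module R e ℓe} {n} {z : Vector (Module.Carrierᴹ E) n}
         {d} {D : Diagram d} {D≤n : InRows n D} {F : Flag E n o ℓo} {G : Flag E n o′ ℓo′}
         (f : FlagHom E F G) where

  private
    a : ∀ j → Vector (Fin n) (size (D j))
    a j = boxRow (D j) (D≤n j)

    TFF = TF E z D D≤n F
    TFG = TF E z D D≤n G
    SF = SchurModule E z D D≤n F
    SG = SchurModule E z D D≤n G

    φ : Hom SF SG
    φ = schurMap E z D D≤n {F = F} {G = G} f

  -- Both Schur modules have the same terms as representatives, and `G⊆F` lets the identity on them
  -- descend to a map from `SG` back to `SF`.
  schurMap-isIso : (∀ j {x} → FlagRelation E G (a j) x →
                    Module._≈ᴹ_ (columnModule E F (a j)) x (Module.0ᴹ (columnModule E F (a j)))) →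
                   IsIso φ
  schurMap-isIso G⊆F = record
    { isModuleMonomorphism = record
      { isModuleHomomorphism = Hom.isHom φ
      ; injective = λ {u} {v} fu≈fv → ≡.subst₂ (Module._≈ᴹ_ SF)
          (inverse∘schurMap u) (inverse∘schurMap v) (Hom.⟦⟧-cong inverse fu≈fv)
      }
    ; surjective = λ y → ⟦ inverse ⟧ y , λ {x} x≈ →
        ≡.subst (Module._≈ᴹ_ SG (⟦ φ ⟧ x)) (schurMap∘inverse y) (Hom.⟦⟧-cong φ x≈)
    }
    where
    columnInverse : ∀ j → Hom (columnModule E G (a j)) (columnModule E F (a j))
    columnInverse j = /-lift {M = ⋀ (size (D j)) E} {N = columnModule E F (a j)}
      (/-proj (⋀ (size (D j)) E) (FlagRelation E F (a j))) (G⊆F j)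

    TInverse : Hom TFG TFF
    TInverse = ⨂-map {M = λ j → columnModule E G (a j)} {N = λ j → columnModule E F (a j)} columnInverse

    inverse : Hom SG SF
    inverse = /-lift {M = TFG} {N = SF}
      (_∘ᴴ_ {M = TFG} {N = TFF} {Q = SF} (/-proj TFF (ExchangeImage E z D D≤n F)) TInverse)
      -- For either flag an exchange relation is the image of an element of `TE` that does not
      -- depend on the flag, so `TInverse` carries one to the other.
      λ {y} (x , x∈Exchange , y≈x) → /-incl TFF (ExchangeImage E z D D≤n F)
        (incl (x , x∈Exchange , Module.≈ᴹ-trans TFF (Hom.⟦⟧-cong TInverse y≈x)
          (⨂-map-∘ {M = λ j → ⋀ (size (D j)) E} {N = λ j → columnModule E G (a j)}
            {Q = λ j → columnModule E F (a j)}
            columnInverse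
            (λ j → /-proj (⋀ (size (D j)) E) (FlagRelation E G (a j)))
            (λ j → /-proj (⋀ (size (D j)) E) (FlagRelation E F (a j)))
            (λ j u → Module.≈ᴹ-refl (columnModule E F (a j))) x)))

    -- Both maps rebuild a term and leave its generators alone; as they recurse on the term, the
    -- composite is the identity only after induction.
    inverse∘schurMap : ∀ t → ⟦ inverse ⟧ (⟦ φ ⟧ t) ≡ t
    inverse∘schurMap (gen v)  = refl
    inverse∘schurMap 0ᵗ       = refl
    inverse∘schurMap (s +ᵗ t) = ≡.cong₂ _+ᵗ_ (inverse∘schurMap s) (inverse∘schurMap t)
    inverse∘schurMap (-ᵗ t)   = ≡.cong -ᵗ_ (inverse∘schurMap t)
    inverse∘schurMap (r *ᵗ t) = ≡.cong (r *ᵗ_) (inverse∘schurMap t)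

    schurMap∘inverse : ∀ t → ⟦ φ ⟧ (⟦ inverse ⟧ t) ≡ t
    schurMap∘inverse (gen v)  = refl
    schurMap∘inverse 0ᵗ       = refl
    schurMap∘inverse (s +ᵗ t) = ≡.cong₂ _+ᵗ_ (schurMap∘inverse s) (schurMap∘inverse t)
    schurMap∘inverse (-ᵗ t)   = ≡.cong -ᵗ_ (schurMap∘inverse t)
    schurMap∘inverse (r *ᵗ t) = ≡.cong (r *ᵗ_) (schurMap∘inverse t)

-- Column relations of the two shifted flags.

row∘boxRow : ∀ {n} (a : Column) (a≤n : ∀ s → box a s ≤ n) s → row (boxRow a a≤n s) ≡ box a s
-- The two bounds mention the box, so they are abstracted along with it; a positive box is a
-- successor, so taking `pred` in `boxRow` loses nothing.
row∘boxRow a a≤n s with box a s | positive a s | a≤n s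
... | suc _ | _ | _ = ≡.cong suc (Fin.toℕ-fromℕ< _)

module _ {R : CommutativeRing c ℓ} (E : Module R e ℓe) {n} (z : Vector (Module.Carrierᴹ E) n) where

  open Module E

  shift-< : ∀ k {i} → i < k → shift E z k i ≡ i
  shift-< k {i} i<k with i ℕ.<? k
  ... | yes _   = refl
  ... | no  i≮k = ⊥-elim (i≮k i<k)

  shift-≥ : ∀ k {i} → k ≤ i → shift E z k i ≡ pred i
  shift-≥ k {i} k≤i with i ℕ.<? k
  ... | yes i<k = ⊥-elim (ℕ.<⇒≱ i<k k≤i)
  ... | no  _   = refl

  shift-suc-≢ : ∀ k {i} → i ≢ k → shift E z k i ≡ shift E z (suc k) i
  shift-suc-≢ k {i} i≢k with ℕ.<-cmp i k
  ... | tri< i<k _ _ = ≡.trans (shift-< k i<k) (≡.sym (shift-< (suc k) (ℕ.m<n⇒m<1+n i<k)))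
  ... | tri≈ _ i≡k _ = ⊥-elim (i≢k i≡k)
  ... | tri> _ _ k<i = ≡.trans (shift-≥ k (ℕ.<⇒≤ k<i)) (≡.sym (shift-≥ (suc k) k<i))

  -- The predicate that `E[ i ]` divides out, so `Span E (Tail i)` is the kernel of `E-proj E z i`.
  Tail : ℕ → Pred Carrierᴹ _
  Tail i v = ∃[ j ] i < row j × v ≈ᴹ z j

  -- Only the generator in row `suc i` is lost in passing from `Tail i` to `Tail (suc i)`, and it is
  -- `z p`.
  Tail⊆LineMod : ∀ {i} (p : Fin n) → row p ≡ suc i →
                 ∀ {v} → Tail i v → LineMod E (Span E (Tail (suc i))) (z p) v
  Tail⊆LineMod p p≡1+i (j , i<j , v≈z) with j Fin.≟ p
  ... | yes refl = CommutativeRing.1# R , 0ᴹ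
      , ≈ᴹ-trans v≈z (≈ᴹ-trans (≈ᴹ-sym (+ᴹ-identityʳ _)) (1x+ E _ _)) , zero
  ... | no  j≢p  = K⇒LineMod E (incl (j
      , ℕ.≤∧≢⇒< i<j (λ 1+i≡j → j≢p (Fin.toℕ-injective (ℕ.suc-injective (≡.sym (≡.trans p≡1+i 1+i≡j)))))
      , v≈z))

  module _ {k} (1≤k : 1 ≤ k) (a : Column) (a≤n : ∀ s → box a s ≤ n) (full : k ∈ a → suc k ∈ a) where

    private
      b : Vector (Fin n) (size a)
      b = boxRow a a≤n

    -- Away from row `k` the flags agree, so the relation is already one of `𝖱 E z (suc k)`. At row
    -- `k` the entries from `s` on lie in ker(E → E_{k-1}), which is the line of `z (b s)` plus
    -- ker(E → E_k); fullness supplies the later box `suc k`, whose relation is the hypothesis of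
    -- `null-LineMod`.
    𝖱-relation-null : ∀ {x} → FlagRelation E (𝖱 E z k) b x →
      let module C = Module (columnModule E (𝖱 E z (suc k)) b) in x C.≈ᴹ C.0ᴹ
    𝖱-relation-null (s , v , v∈ker , x≈v) = C.≈ᴹ-trans (/-cong (⋀ (size a) E) P x≈v) v-null
      where
      P = FlagRelation E (𝖱 E z (suc k)) b
      module C = Module (columnModule E (𝖱 E z (suc k)) b)

      v-null : Null E P v
      v-null with row (b s) ℕ.≟ k
      ... | no  bₛ≢k = /-incl (⋀ (size a) E) P (incl (s , v
          , (λ t s≤t → ≡.subst (λ i → Ker (E-proj E z i) (v t)) (shift-suc-≢ k bₛ≢k) (v∈ker t s≤t))
          , Module.≈ᴹ-refl (⋀ (size a) E)))
      ... | yes bₛ≡k with full (s , ≡.trans (≡.sym (row∘boxRow a a≤n s)) bₛ≡k)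
      ... | s′ , aₛ′≡1+k = null-LineMod E P (Span E (Tail k)) (z (b s)) {s = s} null-K v line
        where
        aₛ≡k : box a s ≡ k
        aₛ≡k = ≡.trans (≡.sym (row∘boxRow a a≤n s)) bₛ≡k

        aₛ<aₛ′ : box a s < box a s′
        aₛ<aₛ′ = ≡.subst₂ _<_ (≡.sym aₛ≡k) (≡.sym aₛ′≡1+k) (ℕ.n<1+n k)

        s<s′ : s Fin.< s′
        s<s′ with Fin.<-cmp s s′
        ... | tri< s<s′ _ _ = s<s′
        ... | tri≈ _ refl _ = ⊥-elim (ℕ.<-irrefl refl aₛ<aₛ′)
        ... | tri> _ _ s′<s = ⊥-elim (ℕ.<-asym aₛ<aₛ′ (increasing a s′<s))

        target : shift E z (suc k) (row (b s′)) ≡ k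
        target = ≡.trans (≡.cong (shift E z (suc k)) (≡.trans (row∘boxRow a a≤n s′) aₛ′≡1+k))
          (shift-≥ (suc k) ℕ.≤-refl)

        source : shift E z k (row (b s)) ≡ pred k
        source = ≡.trans (≡.cong (shift E z k) bₛ≡k) (shift-≥ k ℕ.≤-refl)

        -- By `1 ≤ k` the truncated `pred` is a true predecessor, so `z (b s)`, in row `k`, is the
        -- first generator of `Tail (pred k)`.
        suc-pred : suc (pred k) ≡ k
        suc-pred = ℕ.suc-pred k {{ℕ.>-nonZero 1≤k}}

        null-K : ∀ w → (∀ t → s Fin.< t → Span E (Tail k) (w t)) → Null E P w
        null-K w Kw = /-incl (⋀ (size a) E) P (incl (s′ , w
          , (λ t s′≤t → ≡.subst (λ i → Ker (E-proj E z i) (w t)) (≡.sym target)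
              (/-incl E (Tail k) (Kw t (ℕ.<-≤-trans s<s′ s′≤t))))
          , Module.≈ᴹ-refl (⋀ (size a) E)))

        line : ∀ t → s Fin.≤ t → LineMod E (Span E (Tail k)) (z (b s)) (v t)
        line t s≤t = ≡.subst (λ i → LineMod E (Span E (Tail i)) (z (b s)) (v t)) suc-pred
          (Span⊆LineMod E (Tail⊆LineMod (b s) (≡.trans bₛ≡k (≡.sym suc-pred)))
            (/-zero⇒Span E (Tail (pred k))
              (≡.subst (λ i → Ker (E-proj E z i) (v t)) source (v∈ker t s≤t))))

lemma4p4 : ∀ {c ℓ e ℓe} (R : CommutativeRing c ℓ) (k n : ℕ) → 1 ≤ k → k ≤ n →
    (E : Module R e ℓe) (z : Vector (Module.Carrierᴹ E) n) → IsBasis E z →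
    ∀ {d} (D : Diagram d) (D≤n : InRows n D) → Full k D →
    IsIso (schurMap E z D D≤n {F = 𝖱 E z (suc k)} {G = 𝖱 E z k} (𝖱-step E z k))
lemma4p4 R k n 1≤k _ E z _ D D≤n full =
  schurMap-isIso {F = 𝖱 E z (suc k)} {G = 𝖱 E z k} (𝖱-step E z k)
    λ j → 𝖱-relation-null E z 1≤k (D j) (D≤n j) (full j)
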